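{- If $G$ is a $\{P_4+P_1,C_4\}$-free graph, then $\mathsf{tree}\text{ - }\theta(G)\le 3$.
   Context: All graphs are finite, simple and undirected. $P_4+P_1$ is the disjoint union of the 4-vertex path and a single vertex; $C_4$ is the 4-cycle. A graph is $\mathcal{F}$-free if it has no induced subgraph isomorphic to a member of $\mathcal{F}$. The clique cover number $\theta(H)$ is the minimum number of cliques in a partition of $V(H)$ into cliques. A tree decomposition of $G$ is a pair $(T,\{X_t\}_{t\in V(T)})$ with $T$ a tree and bags $X_t\subseteq V(G)$ such that every vertex lies in some bag, every edge has both endpoints in some bag, and for each vertex $v$ the nodes whose bags contain $v$ induce a connected subtree. The tree-clique-cover number $\mathsf{tree}\text{ - }\theta(G)$ is the minimum, over all tree decompositions of $G$, of $\max_t \theta(G[X_t])$. -}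

module Defs where

open import Data.Nat using (ℕ; zero; suc; _≤_)
open import Data.Fin using (Fin; zero; suc; inject₁; fromℕ)
open import Data.Bool using (Bool; true; false)
open import Data.Product using (Σ; ∃; ∃-syntax; _×_; _,_)
open import Relation.Binary.PropositionalEquality using (_≡_; _≢_)
open import Relation.Nullary using (¬_)
open import Function.Definitions using (Injective)

record Graph : Set where
  field
    n     : ℕ
    adj   : Fin n → Fin n → Bool
    sym   : ∀ u v → adj u v ≡ adj v u
    irrefl : ∀ v → adj v v ≡ false
open Graph public

InducedCopy : (G : Graph) (k : ℕ) (h : Fin k → Fin k → Bool) → Set
InducedCopy G k h =
  Σ (Fin k → Fin (n G)) λ f →
    Injective _≡_ _≡_ f × (∀ i j → h i j ≡ adj G (f i) (f j))

P4+P1-adj : Fin 5 → Fin 5 → Bool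
P4+P1-adj zero (suc zero) = true
P4+P1-adj (suc zero) zero = true
P4+P1-adj (suc zero) (suc (suc zero)) = true
P4+P1-adj (suc (suc zero)) (suc zero) = true
P4+P1-adj (suc (suc zero)) (suc (suc (suc zero))) = true
P4+P1-adj (suc (suc (suc zero))) (suc (suc zero)) = true
P4+P1-adj _ _ = false

C4-adj : Fin 4 → Fin 4 → Bool
C4-adj zero (suc zero) = true
C4-adj (suc zero) zero = true
C4-adj (suc zero) (suc (suc zero)) = true
C4-adj (suc (suc zero)) (suc zero) = true
C4-adj (suc (suc zero)) (suc (suc (suc zero))) = true
C4-adj (suc (suc (suc zero))) (suc (suc zero)) = true
C4-adj (suc (suc (suc zero))) zero = true
C4-adj zero (suc (suc (suc zero))) = true
C4-adj _ _ = false

P4+P1-C4-free : Graph → Set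
P4+P1-C4-free G = ¬ InducedCopy G 5 P4+P1-adj × ¬ InducedCopy G 4 C4-adj

data WalkIn (G : Graph) (P : Fin (n G) → Set) : Fin (n G) → Fin (n G) → Set where
  here : ∀ {a} → P a → WalkIn G P a a
  step : ∀ {a b c} → P a → adj G a b ≡ true → WalkIn G P b c → WalkIn G P a c

ConnectedOn : (G : Graph) → (Fin (n G) → Set) → Set
ConnectedOn G P = ∀ a b → P a → P b → WalkIn G P a b

Connected : Graph → Set
Connected G = ConnectedOn G (λ _ → Data.Unit.⊤)
  where import Data.Unit

Cycle : Graph → Set
Cycle G = Σ ℕ λ k → Σ (Fin (suc (suc (suc k))) → Fin (n G)) λ c →
  Injective _≡_ _≡_ c ×
  (∀ (i : Fin (suc (suc k))) → adj G (c (inject₁ i)) (c (suc i)) ≡ true) ×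
  adj G (c (fromℕ (suc (suc k)))) (c zero) ≡ true

IsTree : Graph → Set
IsTree T = (1 ≤ n T) × Connected T × ¬ Cycle T

record TreeDecomposition (G : Graph) : Set₁ where
  field
    T      : Graph
    isTree : IsTree T
    bag    : Fin (n T) → Fin (n G) → Set
    covers-vertices : ∀ v → ∃[ t ] bag t v
    covers-edges    : ∀ u v → adj G u v ≡ true → ∃[ t ] (bag t u × bag t v)
    subtree         : ∀ v → ConnectedOn T (λ t → bag t v)
open TreeDecomposition public

-- θ(G[X]) ≤ k: X can be partitioned into at most k cliques, i.e. there is
-- an assignment of the vertices of X to k (possibly empty) classes, each a clique.
CliqueCoverAtMost : (G : Graph) → (Fin (n G) → Set) → ℕ → Set
CliqueCoverAtMost G X k =
  Σ (Fin (n G) → Fin k) λ c →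
    ∀ u v → X u → X v → u ≢ v → c u ≡ c v → adj G u v ≡ true

TreeThetaAtMost : Graph → ℕ → Set₁
TreeThetaAtMost G k =
  Σ (TreeDecomposition G) λ D → ∀ t → CliqueCoverAtMost G (bag D t) k

module Submission where

-- Write R for the reflexive closure of adjacency and α for the size of a largest
-- stable set. If α ≤ 3, the whole vertex set is covered by three cliques. For a
-- stable set {a, b, c} of size α = 3, pass to the complement, which is
-- (2K₂, gem, K₄)-free and contains the triangle abc: colour each vertex according to
-- its neighbours on the triangle. The case α = 2 is the same with an edge.
-- If α ≥ 4, there is a clique cutset. Let a belong to a stable 4-set {a, b, c, d}. A
-- component of the nonneighbours of a whose boundary is not a clique yields a hole of
-- length 5 or 6 through a; together with b, c, d a 6-hole is impossible, and a 5-hole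
-- yields a "fork": a 5-hole with two nonadjacent vertices attached to the same edge of
-- it only. A fork exhibits a clique cutset.
-- Decomposing along clique cutsets and attaching the resulting pieces one at a time as
-- leaves gives the tree decomposition.
-- In terms of R, being C₄-free or (P₄+P₁)-free is a Boolean constraint without
-- distinctness conditions, so the facts about few vertices reduce to case trees.

open import Data.Bool using (Bool; true; false; _∨_) renaming (T to IsTrue)
import Data.Bool.Properties as Bool
open import Data.Bool.Properties using (∨-zeroʳ)
open import Data.Empty using (⊥; ⊥-elim)
open import Data.Fin using (Fin; zero; suc; inject₁; fromℕ; toℕ)
open import Data.Fin.Patterns using (0F; 1F; 2F; 3F; 4F)
open import Data.Fin.Properties
  using (_≟_; any?; toℕ-inject₁; toℕ-injective)
open import Data.Fin.Relation.Unary.Top using (view; ‵fromℕ; ‵inject₁)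
open import Data.Fin.Subset
  using (Subset; _∈_; _∉_; _⊆_; _⊂_; _∩_; _∪_; ⁅_⁆)
  renaming (⊥ to ∅; ⊤ to full)
open import Data.Fin.Subset.Induction using (⊂-wellFounded; Acc; acc)
open import Data.Fin.Subset.Properties
  using (_∈?_; ∉⊥; ∈⊤; x∈⁅x⁆; x∈⁅y⁆⇒x≡y; x∈p∪q⁻; x∈p∩q⁻; x∈p∩q⁺; p⊆p∪q; q⊆p∪q; ⊆-antisym)
open import Data.List as List using (List; []; _∷_; _++_)
open import Data.List.Relation.Unary.All as All using (All; []; _∷_)
open import Data.Maybe using (Maybe; just; nothing; is-just; to-witness-T; _<∣>_; _>>=_; map)
open import Data.Nat using (ℕ; _+_; zero; suc; _<_; s<s; s≤s; z≤n)
import Data.Nat.Properties as ℕ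
open import Data.Product using (Σ; ∃; ∃-syntax; _×_; _,_; proj₁; proj₂)
open import Data.Product.Properties using (≡-dec)
open import Data.Sum using (_⊎_; inj₁; inj₂; [_,_]′)
open import Data.Unit using (⊤; tt)
open import Data.Vec using (Vec; []; _∷_; tabulate; lookup)
open import Data.Vec.Relation.Unary.All as VecAll using ([]; _∷_)
open import Data.Vec.Properties using (lookup∘tabulate; lookup⇒[]=; []=⇒lookup)
open import Function using (_∘_; id; case_of_)
open import Function.Definitions using (Injective)
open import Relation.Binary.PropositionalEquality
  using (_≡_; _≢_; refl; ≢-sym; trans; cong; cong₂; subst) renaming (sym to ≡-sym)
open import Relation.Binary.Definitions using (tri<; tri≈; tri>)
open import Relation.Nullary
  using (¬_; Dec; yes; no; does; contradiction; ¬?; _×-dec_; dec⇒maybe; proof; invert; Reflects)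
open import Relation.Nullary.Decidable using (dec-true; decidable-stable)

open import Defs

-- Subsets cut out by decidable predicates

sift : ∀ {m} {P : Fin m → Set} → (∀ v → Dec (P v)) → Subset m
sift P? = tabulate (does ∘ P?)

∈-sift⁺ : ∀ {m} {P : Fin m → Set} (P? : ∀ v → Dec (P v)) {v} → P v → v ∈ sift P?
∈-sift⁺ P? {v} p = lookup⇒[]= v _ (trans (lookup∘tabulate _ v) (dec-true (P? v) p))

∈-sift⁻ : ∀ {m} {P : Fin m → Set} (P? : ∀ v → Dec (P v)) {v} → v ∈ sift P? → P v
∈-sift⁻ {P = P} P? {v} v∈ =
  invert (subst (Reflects (P v)) (trans (≡-sym (lookup∘tabulate _ v)) ([]=⇒lookup v∈)) (proof (P? v)))

-- Trees

addLeaf : (T : Graph) → Fin (n T) → Graph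
addLeaf T t = record { n = suc (n T) ; adj = adj′ ; sym = sym′ ; irrefl = irrefl′ }
  where
  adj′ : Fin (suc (n T)) → Fin (suc (n T)) → Bool
  adj′ zero    zero    = false
  adj′ zero    (suc j) = does (j ≟ t)
  adj′ (suc i) zero    = does (i ≟ t)
  adj′ (suc i) (suc j) = adj T i j
  sym′ : ∀ i j → adj′ i j ≡ adj′ j i
  sym′ zero    zero    = refl
  sym′ zero    (suc j) = refl
  sym′ (suc i) zero    = refl
  sym′ (suc i) (suc j) = sym T i j
  irrefl′ : ∀ i → adj′ i i ≡ false
  irrefl′ zero    = refl
  irrefl′ (suc i) = irrefl T i

leaf-neighbour : ∀ (T : Graph) t x → adj (addLeaf T t) zero x ≡ true → x ≡ suc t
leaf-neighbour T t (suc j) e with j ≟ t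
... | yes j≡t = cong suc j≡t

-- A walk between the leaf and an old node is a walk from `t` extended by one edge; the second
-- premise puts `t` in `P` when this is required.
ConnectedOn-addLeaf : ∀ (T : Graph) t (P : Fin (suc (n T)) → Set) →
  ConnectedOn T (P ∘ suc) → (P zero → ∀ j → P (suc j) → P (suc t)) →
  ConnectedOn (addLeaf T t) P
ConnectedOn-addLeaf T t P conn attach = go
  where
  T′ = addLeaf T t
  lift : ∀ {a b} → WalkIn T (P ∘ suc) a b → WalkIn T′ P (suc a) (suc b)
  lift (here p)     = here p
  lift (step p e w) = step p e (lift w)
  snoc : ∀ {a b c} → WalkIn T′ P a b → adj T′ b c ≡ true → P c → WalkIn T′ P a c
  snoc (here p)     e q = step p e (here q)
  snoc (step p f w) e q = step p f (snoc w e q)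
  go : ConnectedOn T′ P
  go zero    zero    p q = here p
  go zero    (suc b) p q = step p (dec-true (t ≟ t) refl) (lift (conn t b (attach p b q) q))
  go (suc a) zero    p q = snoc (lift (conn a t p (attach q a p))) (dec-true (t ≟ t) refl) q
  go (suc a) (suc b) p q = lift (conn a b p q)

-- A cycle through the leaf would visit the unique neighbour of the leaf twice.
cycle-avoids-leaf : ∀ (T : Graph) t k (c : Fin (3 + k) → Fin (suc (n T))) →
  Injective _≡_ _≡_ c →
  (∀ i → adj (addLeaf T t) (c (inject₁ i)) (c (suc i)) ≡ true) →
  adj (addLeaf T t) (c (fromℕ (2 + k))) (c zero) ≡ true →
  ∀ i → c i ≢ zero
cycle-avoids-leaf T t k c inj edge close = avoid
  where
  T′ = addLeaf T t
  after : ∀ {x y} → adj T′ x y ≡ true → x ≡ zero → y ≡ suc t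
  after {y = y} e refl = leaf-neighbour T t y e
  before : ∀ {x y} → adj T′ x y ≡ true → y ≡ zero → x ≡ suc t
  before {x} {y} e y≡0 = after (trans (sym T′ y x) e) y≡0
  clash : ∀ {i j} → c i ≡ suc t → c j ≡ suc t → i ≢ j → ⊥
  clash p q i≢j = i≢j (inj (trans p (≡-sym q)))
  avoid : ∀ i → c i ≢ zero
  avoid zero e = clash (after (edge zero) e) (before close e) λ ()
  avoid (suc i) e with view i
  ... | ‵fromℕ = clash (before (edge i) e) (after close e) λ ()
  -- The two neighbours of the leaf have positions `j` and `j + 2` on the cycle.
  ... | ‵inject₁ j = clash (before (edge i) e) (after (edge (suc j)) e)
    λ eq → ℕ.m≢1+n+m (toℕ j) {1} (trans (≡-sym (trans (toℕ-inject₁ (inject₁ j)) (toℕ-inject₁ j))) (cong toℕ eq))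

IsTree-addLeaf : ∀ (T : Graph) t → IsTree T → IsTree (addLeaf T t)
IsTree-addLeaf T t (_ , conn , acyclic) = s≤s z≤n , conn′ , acyclic′
  where
  conn′ : Connected (addLeaf T t)
  conn′ = ConnectedOn-addLeaf T t _ conn (λ _ _ _ → tt)
  acyclic′ : ¬ Cycle (addLeaf T t)
  acyclic′ (k , c , inj , edge , close) = acyclic (k , c′ , inj′ , edge′ , close′)
    where
    lower : ∀ x → x ≢ zero → ∃ λ y → x ≡ suc y
    lower zero    x≢0 = contradiction refl x≢0
    lower (suc y) _   = y , refl
    below = λ i → lower (c i) (cycle-avoids-leaf T t k c inj edge close i)
    c′ = λ i → proj₁ (below i)
    c≡ = λ i → proj₂ (below i)
    inj′ : Injective _≡_ _≡_ c′
    inj′ {i} {j} e = inj (trans (c≡ i) (trans (cong suc e) (≡-sym (c≡ j))))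
    edge′ : ∀ i → adj T (c′ (inject₁ i)) (c′ (suc i)) ≡ true
    edge′ i = subst (_≡ true) (cong₂ (adj (addLeaf T t)) (c≡ (inject₁ i)) (c≡ (suc i))) (edge i)
    close′ : adj T (c′ (fromℕ (2 + k))) (c′ zero) ≡ true
    close′ = subst (_≡ true) (cong₂ (adj (addLeaf T t)) (c≡ (fromℕ _)) (c≡ zero)) close

singleton : Graph
singleton = record { n = 1 ; adj = λ _ _ → false ; sym = λ _ _ → refl ; irrefl = λ _ → refl }

IsTree-singleton : IsTree singleton
IsTree-singleton = s≤s z≤n , (λ { 0F 0F _ _ → here tt }) , λ { (k , c , _ , edge , _) → case edge zero of λ () }

-- Certified local configurations

-- (i , j , b) asserts that the closed adjacency of the i-th and j-th vertex is b.
Literal : Set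
Literal = ℕ × ℕ × Bool

Context : Set
Context = List Literal

infix 6 _∼_ _≁_

pattern _∼_ i j = i , j , true
pattern _≁_ i j = i , j , false

_≟L_ : (l m : Literal) → Dec (l ≡ m)
_≟L_ = ≡-dec ℕ._≟_ (≡-dec ℕ._≟_ Bool._≟_)

square : ℕ → ℕ → ℕ → ℕ → Context
square i j k l = i ∼ j ∷ j ∼ k ∷ k ∼ l ∷ l ∼ i ∷ i ≁ k ∷ j ≁ l ∷ []

path+point : ℕ → ℕ → ℕ → ℕ → ℕ → Context
path+point i j k l m =
  i ∼ j ∷ j ∼ k ∷ k ∼ l ∷ i ≁ k ∷ i ≁ l ∷ j ≁ l ∷ m ≁ i ∷ m ≁ j ∷ m ≁ k ∷ m ≁ l ∷ []

-- A refutation tree: a case split on a literal, or a leaf at which the literals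
-- gathered so far contain a forbidden subgraph or one of the goals.
data Certificate : Set where
  split : ℕ → ℕ → Certificate → Certificate → Certificate
  c4    : ℕ → ℕ → ℕ → ℕ → Certificate
  p4    : ℕ → ℕ → ℕ → ℕ → ℕ → Certificate
  goal  : ℕ → Certificate

-- Repeating the last vertex makes the lookup total.
at : ∀ {A : Set} {k} → Vec A (suc k) → ℕ → A
at (x ∷ _)      zero    = x
at (x ∷ [])     (suc _) = x
at (_ ∷ y ∷ xs) (suc i) = at (y ∷ xs) i

hole5 : ℕ → ℕ → ℕ → ℕ → ℕ → Context
hole5 a b c d e =
  a ∼ b ∷ b ∼ c ∷ c ∼ d ∷ d ∼ e ∷ e ∼ a ∷ a ≁ c ∷ a ≁ d ∷ b ≁ d ∷ b ≁ e ∷ c ≁ e ∷ []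

hole6 : ℕ → ℕ → ℕ → ℕ → ℕ → ℕ → Context
hole6 a b c d e f =
  a ∼ b ∷ b ∼ c ∷ c ∼ d ∷ d ∼ e ∷ e ∼ f ∷ f ∼ a ∷
  a ≁ c ∷ a ≁ d ∷ a ≁ e ∷ b ≁ d ∷ b ≁ e ∷ b ≁ f ∷ c ≁ e ∷ c ≁ f ∷ d ≁ f ∷ []

fork : Vec ℕ 7 → Context
fork (a ∷ b ∷ c ∷ d ∷ e ∷ p ∷ q ∷ []) = hole5 a b c d e ++
  p ∼ a ∷ p ∼ b ∷ p ≁ c ∷ p ≁ d ∷ p ≁ e ∷
  q ∼ a ∷ q ∼ b ∷ q ≁ c ∷ q ≁ d ∷ q ≁ e ∷ p ≁ q ∷ []

-- For a hole 01234 and vertices 5, 6, 7 missing 0: two of the three are the tips, attached to one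
-- of the edges 12, 23, 34, which avoid 0.
forks : List (Vec ℕ 7)
forks =
  (1 ∷ 2 ∷ 3 ∷ 4 ∷ 0 ∷ 5 ∷ 6 ∷ []) ∷ (2 ∷ 3 ∷ 4 ∷ 0 ∷ 1 ∷ 5 ∷ 6 ∷ []) ∷ (3 ∷ 4 ∷ 0 ∷ 1 ∷ 2 ∷ 5 ∷ 6 ∷ []) ∷
  (1 ∷ 2 ∷ 3 ∷ 4 ∷ 0 ∷ 5 ∷ 7 ∷ []) ∷ (2 ∷ 3 ∷ 4 ∷ 0 ∷ 1 ∷ 5 ∷ 7 ∷ []) ∷ (3 ∷ 4 ∷ 0 ∷ 1 ∷ 2 ∷ 5 ∷ 7 ∷ []) ∷
  (1 ∷ 2 ∷ 3 ∷ 4 ∷ 0 ∷ 6 ∷ 7 ∷ []) ∷ (2 ∷ 3 ∷ 4 ∷ 0 ∷ 1 ∷ 6 ∷ 7 ∷ []) ∷ (3 ∷ 4 ∷ 0 ∷ 1 ∷ 2 ∷ 6 ∷ 7 ∷ []) ∷ []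

fork₀ : Context
fork₀ = fork (0 ∷ 1 ∷ 2 ∷ 3 ∷ 4 ∷ 5 ∷ 6 ∷ [])

-- Closed adjacency

module _ (G : Graph) where

  V : Set
  V = Fin (n G)

  R : V → V → Bool
  R u v = does (u ≟ v) ∨ adj G u v

  R-refl : ∀ v → R v v ≡ true
  R-refl v rewrite dec-true (v ≟ v) refl = refl

  R-sym : ∀ u v → R u v ≡ R v u
  R-sym u v with u ≟ v | v ≟ u
  ... | yes _   | yes _   = refl
  ... | yes u≡v | no v≢u  = contradiction (≡-sym u≡v) v≢u
  ... | no u≢v  | yes v≡u = contradiction (≡-sym v≡u) u≢v
  ... | no _    | no _    = sym G u v

  adj⇒R : ∀ {u v} → adj G u v ≡ true → R u v ≡ true
  adj⇒R e rewrite e = ∨-zeroʳ _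

  R⇒adj : ∀ {u v} → u ≢ v → R u v ≡ true → adj G u v ≡ true
  R⇒adj {u} {v} u≢v r with u ≟ v
  ... | yes u≡v = contradiction u≡v u≢v
  ... | no _    = r

  ¬R⇒≢ : ∀ {u v} → R u v ≡ false → u ≢ v
  ¬R⇒≢ {u} r refl = case trans (≡-sym r) (R-refl u) of λ ()

  ¬R⇒¬adj : ∀ {u v} → R u v ≡ false → adj G u v ≡ false
  ¬R⇒¬adj {u} {v} r with u ≟ v
  ... | no _ = r

  Clique : Subset (n G) → Set
  Clique Q = ∀ {u v} → u ∈ Q → v ∈ Q → R u v ≡ true

  -- Clique separations and gluing along cliques

  -- `separated` forbids edges between `left` minus `right` and `right` minus `left`. Both
  -- inclusions are strict so that recursion on the sides terminates.
  record CliqueSeparation (S : Subset (n G)) : Set where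
    field
      left right   : Subset (n G)
      left⊂        : left ⊂ S
      right⊂       : right ⊂ S
      covers       : ∀ {v} → v ∈ S → v ∈ left ⊎ v ∈ right
      middle       : ∀ {u v} → u ∈ left → u ∈ right → v ∈ left → v ∈ right → R u v ≡ true
      separated    : ∀ {u v} → u ∈ left → v ∈ right → R u v ≡ true → u ∈ right ⊎ v ∈ left

  swap-sides : ∀ {S} → CliqueSeparation S → CliqueSeparation S
  swap-sides sep = record
    { left = right ; right = left ; left⊂ = right⊂ ; right⊂ = left⊂
    ; covers = λ v∈ → [ inj₂ , inj₁ ]′ (covers v∈)
    ; middle = λ u∈r u∈l v∈r v∈l → middle u∈l u∈r v∈l v∈r
    ; separated = λ {u} {v} u∈r v∈l e →
        [ inj₂ , inj₁ ]′ (separated v∈l u∈r (trans (R-sym v u) e))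
    }
    where open CliqueSeparation sep

  -- The Helly property subsumes the coverage of vertices and edges, which are
  -- cliques; it also survives attaching a leaf.
  record PartialDecomposition (X : Subset (n G)) : Set₁ where
    field
      tree    : Graph
      is-tree : IsTree tree
      piece   : Fin (n tree) → Subset (n G)
      piece⊆  : ∀ t → piece t ⊆ X
      linked  : ∀ v → ConnectedOn tree (λ t → v ∈ piece t)
      helly   : ∀ Q → Q ⊆ X → Clique Q → ∃[ t ] Q ⊆ piece t
      thin    : ∀ t → CliqueCoverAtMost G (_∈ piece t) 3
  open PartialDecomposition

  -- The Helly property supplies a bag containing the clique `X ∩ B`, and `B` is hung there as a
  -- leaf. A clique with a vertex outside `X` lies in `B` by the separation premise.
  attach : ∀ {X} B → PartialDecomposition X → Clique (X ∩ B) →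
    (∀ {u v} → u ∈ X → v ∈ B → R u v ≡ true → u ∈ B ⊎ v ∈ X) →
    CliqueCoverAtMost G (_∈ B) 3 → PartialDecomposition (X ∪ B)
  attach {X} B D clique sep thinB
    with helly D (X ∩ B) (proj₁ ∘ x∈p∩q⁻ X B) clique
  ... | t , X∩B⊆t = record
    { tree = addLeaf (tree D) t
    ; is-tree = IsTree-addLeaf (tree D) t (is-tree D)
    ; piece = piece′
    ; piece⊆ = λ { zero → q⊆p∪q X B ; (suc j) → p⊆p∪q B ∘ piece⊆ D j }
    ; linked = λ v → ConnectedOn-addLeaf (tree D) t (λ i → v ∈ piece′ i) (linked D v)
        λ v∈B j v∈j → X∩B⊆t (x∈p∩q⁺ (piece⊆ D j v∈j , v∈B))
    ; helly = helly′
    ; thin = λ { zero → thinB ; (suc j) → thin D j }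
    }
    where
    piece′ : Fin (suc (n (tree D))) → Subset (n G)
    piece′ zero    = B
    piece′ (suc j) = piece D j
    helly′ : ∀ Q → Q ⊆ X ∪ B → Clique Q → ∃[ i ] Q ⊆ piece′ i
    helly′ Q Q⊆ cl with any? (λ q → (q ∈? Q) ×-dec ¬? (q ∈? X))
    ... | no none = let j , Q⊆j = helly D Q Q⊆X cl in suc j , Q⊆j
      where
      Q⊆X : Q ⊆ X
      Q⊆X {q} q∈Q with q ∈? X
      ... | yes q∈X = q∈X
      ... | no q∉X  = contradiction (q , q∈Q , q∉X) none
    ... | yes (q , q∈Q , q∉X) = zero , Q⊆B
      where
      Q⊆B : Q ⊆ B
      Q⊆B q′∈Q with x∈p∪q⁻ X B (Q⊆ q′∈Q) | x∈p∪q⁻ X B (Q⊆ q∈Q)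
      ... | inj₂ q′∈B | _        = q′∈B
      ... | inj₁ _    | inj₁ q∈X = contradiction q∈X q∉X
      ... | inj₁ q′∈X | inj₂ q∈B =
        [ id , (λ q∈X → contradiction q∈X q∉X) ]′ (sep q′∈X q∈B (cl q′∈Q q∈Q))

  -- The clique `X ∩ Y` lies within one side of any clique separation of `Y`. That side is added
  -- first; the other one then meets everything present in the middle clique.
  extend : (∀ S → CliqueCoverAtMost G (_∈ S) 3 ⊎ CliqueSeparation S) →
    ∀ Y → Acc _⊂_ Y → ∀ {X} → PartialDecomposition X → Clique (X ∩ Y) →
    (∀ {u v} → u ∈ X → v ∈ Y → R u v ≡ true → u ∈ Y ⊎ v ∈ X) →
    PartialDecomposition (X ∪ Y)
  extend atom Y (acc rec) {X} D clique sep = [ attach Y D clique sep , by-cut ]′ (atom Y)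
    where
    via : (c : CliqueSeparation Y) →
      (∀ {v} → v ∈ X → v ∈ Y → v ∈ CliqueSeparation.left c) → PartialDecomposition (X ∪ Y)
    via c X∩Y⊆left = subst PartialDecomposition (⊆-antisym ⊆Y Y⊆) D₂
      where
      open CliqueSeparation c
      left⊆ : left ⊆ Y
      left⊆ = proj₁ left⊂
      right⊆ : right ⊆ Y
      right⊆ = proj₁ right⊂
      D₁ : PartialDecomposition (X ∪ left)
      D₁ = extend atom left (rec left⊂) D
        (λ u∈ v∈ →
          let u∈X , u∈l = x∈p∩q⁻ X left u∈ ; v∈X , v∈l = x∈p∩q⁻ X left v∈
          in clique (x∈p∩q⁺ (u∈X , left⊆ u∈l)) (x∈p∩q⁺ (v∈X , left⊆ v∈l)))
        (λ u∈X v∈l e → [ inj₁ ∘ X∩Y⊆left u∈X , inj₂ ]′ (sep u∈X (left⊆ v∈l) e))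
      in-left : ∀ {u} → u ∈ X ∪ left → u ∈ right → u ∈ left
      in-left u∈ u∈r =
        [ (λ u∈X → X∩Y⊆left u∈X (right⊆ u∈r)) , id ]′ (x∈p∪q⁻ X left u∈)
      from-left : ∀ {u v} → u ∈ left → v ∈ right → R u v ≡ true → u ∈ right ⊎ v ∈ X ∪ left
      from-left u∈l v∈r e = [ inj₁ , inj₂ ∘ q⊆p∪q X left ]′ (separated u∈l v∈r e)
      sep₂ : ∀ {u v} → u ∈ X ∪ left → v ∈ right → R u v ≡ true → u ∈ right ⊎ v ∈ X ∪ left
      sep₂ u∈ v∈r e with x∈p∪q⁻ X left u∈
      ... | inj₂ u∈l = from-left u∈l v∈r e
      ... | inj₁ u∈X with sep u∈X (right⊆ v∈r) e
      ...   | inj₁ u∈Y = from-left (X∩Y⊆left u∈X u∈Y) v∈r e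
      ...   | inj₂ v∈X = inj₂ (p⊆p∪q left v∈X)
      D₂ : PartialDecomposition ((X ∪ left) ∪ right)
      D₂ = extend atom right (rec right⊂) D₁
        (λ u∈ v∈ →
          let u∈₁ , u∈r = x∈p∩q⁻ (X ∪ left) right u∈ ; v∈₁ , v∈r = x∈p∩q⁻ (X ∪ left) right v∈
          in middle (in-left u∈₁ u∈r) u∈r (in-left v∈₁ v∈r) v∈r)
        sep₂
      ⊆Y : (X ∪ left) ∪ right ⊆ X ∪ Y
      ⊆Y v∈ with x∈p∪q⁻ (X ∪ left) right v∈
      ... | inj₂ v∈r = q⊆p∪q X Y (right⊆ v∈r)
      ... | inj₁ v∈₁ = [ p⊆p∪q Y , q⊆p∪q X Y ∘ left⊆ ]′ (x∈p∪q⁻ X left v∈₁)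
      Y⊆ : X ∪ Y ⊆ (X ∪ left) ∪ right
      Y⊆ v∈ with x∈p∪q⁻ X Y v∈
      ... | inj₁ v∈X = p⊆p∪q right (p⊆p∪q left v∈X)
      ... | inj₂ v∈Y = [ p⊆p∪q right ∘ q⊆p∪q X left , q⊆p∪q (X ∪ left) right ]′ (covers v∈Y)

    by-cut : CliqueSeparation Y → PartialDecomposition (X ∪ Y)
    by-cut cut with any? (λ v → (v ∈? X ∩ Y) ×-dec ¬? (v ∈? CliqueSeparation.left cut))
    ... | no none = via cut X∩Y⊆left
      where
      X∩Y⊆left : ∀ {v} → v ∈ X → v ∈ Y → v ∈ CliqueSeparation.left cut
      X∩Y⊆left {v} v∈X v∈Y with v ∈? CliqueSeparation.left cut
      ... | yes v∈l = v∈l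
      ... | no v∉l  = contradiction (v , x∈p∩q⁺ (v∈X , v∈Y) , v∉l) none
    -- `k` sees the whole clique `X ∩ Y` and is not in `left`, so no vertex of this clique can lie
    -- in `left` only.
    ... | yes (k , k∈ , k∉l) = via (swap-sides cut) X∩Y⊆right
      where
      open CliqueSeparation cut
      k∈Y : k ∈ Y
      k∈Y = proj₂ (x∈p∩q⁻ X Y k∈)
      k∈r : k ∈ right
      k∈r = [ (λ k∈l → contradiction k∈l k∉l) , id ]′ (covers k∈Y)
      X∩Y⊆right : ∀ {v} → v ∈ X → v ∈ Y → v ∈ right
      X∩Y⊆right v∈X v∈Y with covers v∈Y
      ... | inj₂ v∈r = v∈r
      ... | inj₁ v∈l = [ id , (λ k∈l → contradiction k∈l k∉l) ]′
        (separated v∈l k∈r (clique (x∈p∩q⁺ (v∈X , v∈Y)) k∈))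

  tree-theta : (∀ S → CliqueCoverAtMost G (_∈ S) 3 ⊎ CliqueSeparation S) → TreeThetaAtMost G 3
  tree-theta atom = record
    { T = tree D
    ; isTree = is-tree D
    ; bag = λ t v → v ∈ piece D t
    ; covers-vertices = λ v →
        let t , v∈t = helly D ⁅ v ⁆ everywhere λ x∈ y∈ →
              subst (λ x → R x _ ≡ true) (≡-sym (x∈⁅y⁆⇒x≡y v x∈))
                (subst (λ y → R v y ≡ true) (≡-sym (x∈⁅y⁆⇒x≡y v y∈)) (R-refl v))
        in t , v∈t (x∈⁅x⁆ v)
    ; covers-edges = λ u v e →
        let t , uv∈t = helly D (⁅ u ⁆ ∪ ⁅ v ⁆) everywhere (edge-clique e)
        in t , uv∈t (p⊆p∪q ⁅ v ⁆ (x∈⁅x⁆ u)) , uv∈t (q⊆p∪q ⁅ u ⁆ ⁅ v ⁆ (x∈⁅x⁆ v))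
    ; subtree = linked D
    } , thin D
    where
    -- A tree has at least one node, so the recursion starts from a single empty bag.
    empty : PartialDecomposition ∅
    empty = record
      { tree = singleton ; is-tree = IsTree-singleton ; piece = λ _ → ∅
      ; piece⊆ = λ _ → id
      ; linked = λ v _ _ v∈ → contradiction v∈ ∉⊥
      ; helly = λ Q Q⊆ _ → zero , Q⊆
      ; thin = λ _ → (λ _ → zero) , λ u v u∈ → contradiction u∈ ∉⊥ }
    D : PartialDecomposition (∅ ∪ full)
    D = extend atom full (⊂-wellFounded full) empty
      (λ u∈ → contradiction (proj₁ (x∈p∩q⁻ ∅ full u∈)) ∉⊥)
      (λ u∈ → contradiction u∈ ∉⊥)
    everywhere : ∀ {Q} → Q ⊆ ∅ ∪ full
    everywhere _ = q⊆p∪q ∅ full ∈⊤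
    edge-clique : ∀ {u v} → adj G u v ≡ true → Clique (⁅ u ⁆ ∪ ⁅ v ⁆)
    edge-clique {u} {v} e x∈ y∈ with x∈p∪q⁻ ⁅ u ⁆ ⁅ v ⁆ x∈ | x∈p∪q⁻ ⁅ u ⁆ ⁅ v ⁆ y∈
    ... | inj₁ x∈u | inj₁ y∈u rewrite x∈⁅y⁆⇒x≡y u x∈u | x∈⁅y⁆⇒x≡y u y∈u = R-refl u
    ... | inj₁ x∈u | inj₂ y∈v rewrite x∈⁅y⁆⇒x≡y u x∈u | x∈⁅y⁆⇒x≡y v y∈v = adj⇒R e
    ... | inj₂ x∈v | inj₁ y∈u rewrite x∈⁅y⁆⇒x≡y v x∈v | x∈⁅y⁆⇒x≡y u y∈u = adj⇒R (trans (sym G v u) e)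
    ... | inj₂ x∈v | inj₂ y∈v rewrite x∈⁅y⁆⇒x≡y v x∈v | x∈⁅y⁆⇒x≡y v y∈v = R-refl v

  -- Truth of contexts and induced copies

  infix 4 _⊨_

  _⊨_ : (ℕ → V) → Context → Set
  ρ ⊨ []              = ⊤
  ρ ⊨ (i , j , b) ∷ Γ = R (ρ i) (ρ j) ≡ b × ρ ⊨ Γ

  ⊨-++ : ∀ {ρ} Γ {Δ} → ρ ⊨ Γ → ρ ⊨ Δ → ρ ⊨ Γ ++ Δ
  ⊨-++ []      _       q = q
  ⊨-++ (_ ∷ Γ) (p , ps) q = p , ⊨-++ Γ ps q

  OneOf : (ℕ → V) → List Context → Set
  OneOf ρ []       = ⊥
  OneOf ρ (Δ ∷ Δs) = ρ ⊨ Δ ⊎ OneOf ρ Δs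

  induced-copy : ∀ {k} {h : Fin k → Fin k → Bool} (f : Fin k → V) →
    (∀ i j → h i j ≡ h j i) → (∀ i → h i i ≡ false) →
    (∀ i j → toℕ i < toℕ j → f i ≢ f j × h i j ≡ adj G (f i) (f j)) → InducedCopy G k h
  induced-copy {h = h} f h-sym h-irrefl upper = f , inj , same
    where
    inj : Injective _≡_ _≡_ f
    inj {i} {j} e with ℕ.<-cmp (toℕ i) (toℕ j)
    ... | tri< i<j _ _ = contradiction e (proj₁ (upper i j i<j))
    ... | tri≈ _ i≡j _ = toℕ-injective i≡j
    ... | tri> _ _ j<i = contradiction (≡-sym e) (proj₁ (upper j i j<i))
    same : ∀ i j → h i j ≡ adj G (f i) (f j)
    same i j with ℕ.<-cmp (toℕ i) (toℕ j)
    ... | tri< i<j _ _ = proj₂ (upper i j i<j)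
    ... | tri> _ _ j<i = trans (h-sym i j) (trans (proj₂ (upper j i j<i)) (sym G (f j) (f i)))
    ... | tri≈ _ i≡j _ with toℕ-injective i≡j
    ...   | refl = trans (h-irrefl i) (≡-sym (irrefl G (f i)))

  module _ (free : P4+P1-C4-free G) where

    -- The forbidden subgraphs in terms of `R`

    non-edge : ∀ {u v} → R u v ≡ false → u ≢ v × false ≡ adj G u v
    non-edge r = ¬R⇒≢ r , ≡-sym (¬R⇒¬adj r)

    edge : ∀ {u v} → u ≢ v → R u v ≡ true → u ≢ v × true ≡ adj G u v
    edge u≢v r = u≢v , ≡-sym (R⇒adj u≢v r)

    separates : ∀ {u v w} → R u w ≡ false → R v w ≡ true → u ≢ v
    separates p q refl = case trans (≡-sym p) q of λ ()

    flip-R : ∀ {u v b} → R u v ≡ b → R v u ≡ b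
    flip-R {u} {v} = trans (R-sym v u)

    -- `R` does not exclude equality, but any two consecutive vertices are told apart by a third one
    -- that only one of them sees.
    no-square : ∀ ρ i j k l → ¬ (ρ ⊨ square i j k l)
    no-square ρ i j k l (ij , jk , kl , li , ik , jl , _) =
      proj₂ free (induced-copy {h = C4-adj} f
        (λ { 0F 0F → refl ; 0F 1F → refl ; 0F 2F → refl ; 0F 3F → refl
           ; 1F 0F → refl ; 1F 1F → refl ; 1F 2F → refl ; 1F 3F → refl
           ; 2F 0F → refl ; 2F 1F → refl ; 2F 2F → refl ; 2F 3F → refl
           ; 3F 0F → refl ; 3F 1F → refl ; 3F 2F → refl ; 3F 3F → refl })
        (λ { 0F → refl ; 1F → refl ; 2F → refl ; 3F → refl }) upper)
      where
      f : Fin 4 → V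
      f = lookup (ρ i ∷ ρ j ∷ ρ k ∷ ρ l ∷ [])
      upper : ∀ x y → toℕ x < toℕ y → f x ≢ f y × C4-adj x y ≡ adj G (f x) (f y)
      upper 0F 1F _ = edge (separates ik jk) ij
      upper 0F 2F _ = non-edge ik
      upper 0F 3F _ = edge (separates ik (flip-R kl)) (flip-R li)
      upper 1F 2F _ = edge (separates jl kl) jk
      upper 1F 3F _ = non-edge jl
      upper 2F 3F _ = edge (separates (flip-R ik) li) kl
      upper (suc _) 1F (s<s ())
      upper (suc (suc _)) 2F (s<s (s<s ()))
      upper (suc (suc (suc _))) 3F (s<s (s<s (s<s ())))

    no-path+point : ∀ ρ i j k l m → ¬ (ρ ⊨ path+point i j k l m)
    no-path+point ρ i j k l m (ij , jk , kl , ik , il , jl , mi , mj , mk , ml , _) =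
      proj₁ free (induced-copy {h = P4+P1-adj} f
        (λ { 0F 0F → refl ; 0F 1F → refl ; 0F 2F → refl ; 0F 3F → refl ; 0F 4F → refl
           ; 1F 0F → refl ; 1F 1F → refl ; 1F 2F → refl ; 1F 3F → refl ; 1F 4F → refl
           ; 2F 0F → refl ; 2F 1F → refl ; 2F 2F → refl ; 2F 3F → refl ; 2F 4F → refl
           ; 3F 0F → refl ; 3F 1F → refl ; 3F 2F → refl ; 3F 3F → refl ; 3F 4F → refl
           ; 4F 0F → refl ; 4F 1F → refl ; 4F 2F → refl ; 4F 3F → refl ; 4F 4F → refl })
        (λ { 0F → refl ; 1F → refl ; 2F → refl ; 3F → refl ; 4F → refl }) upper)
      where
      f : Fin 5 → V
      f = lookup (ρ i ∷ ρ j ∷ ρ k ∷ ρ l ∷ ρ m ∷ [])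
      upper : ∀ x y → toℕ x < toℕ y → f x ≢ f y × P4+P1-adj x y ≡ adj G (f x) (f y)
      upper 0F 1F _ = edge (separates ik jk) ij
      upper 0F 2F _ = non-edge ik
      upper 0F 3F _ = non-edge il
      upper 0F 4F _ = non-edge (flip-R mi)
      upper 1F 2F _ = edge (separates jl kl) jk
      upper 1F 3F _ = non-edge jl
      upper 1F 4F _ = non-edge (flip-R mj)
      upper 2F 3F _ = edge (≢-sym (separates (flip-R jl) (flip-R jk))) kl
      upper 2F 4F _ = non-edge (flip-R mk)
      upper 3F 4F _ = non-edge (flip-R ml)
      upper (suc _) 1F (s<s ())
      upper (suc (suc _)) 2F (s<s (s<s ()))
      upper (suc (suc (suc _))) 3F (s<s (s<s (s<s ())))
      upper (suc (suc (suc (suc _)))) 4F (s<s (s<s (s<s (s<s ()))))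

    -- Checking refutation trees

    Entails : Context → List Context → Set
    Entails Γ Δs = ∀ ρ → ρ ⊨ Γ → OneOf ρ Δs

    find : ∀ Γ i j b → Maybe (∀ ρ → ρ ⊨ Γ → R (ρ i) (ρ j) ≡ b)
    find []      i j b = nothing
    find (l ∷ Γ) i j b =
      map (λ { refl ρ (p , _) → p }) (dec⇒maybe (l ≟L (i , j , b))) <∣>
      map (λ { refl ρ (p , _) → flip-R p }) (dec⇒maybe (l ≟L (j , i , b))) <∣>
      map (λ f ρ (_ , ps) → f ρ ps) (find Γ i j b)

    find-all : ∀ Γ Δ → Maybe (∀ ρ → ρ ⊨ Γ → ρ ⊨ Δ)
    find-all Γ []              = just λ _ _ → tt
    find-all Γ ((i , j , b) ∷ Δ) = do
      f ← find Γ i j b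
      g ← find-all Γ Δ
      just λ ρ ps → f ρ ps , g ρ ps

    find-goal : ∀ Γ Δs → ℕ → Maybe (Entails Γ Δs)
    find-goal Γ []       _       = nothing
    find-goal Γ (Δ ∷ Δs) zero    = map (λ f ρ ps → inj₁ (f ρ ps)) (find-all Γ Δ)
    find-goal Γ (Δ ∷ Δs) (suc m) = map (λ f ρ ps → inj₂ (f ρ ps)) (find-goal Γ Δs m)

    -- Sound by construction: a successful check returns the entailment itself.
    check : ∀ Γ Δs → Certificate → Maybe (Entails Γ Δs)
    check Γ Δs (goal m)         = find-goal Γ Δs m
    check Γ Δs (c4 i j k l)     =
      map (λ f ρ ps → ⊥-elim (no-square ρ i j k l (f ρ ps))) (find-all Γ (square i j k l))
    check Γ Δs (p4 i j k l m)   =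
      map (λ f ρ ps → ⊥-elim (no-path+point ρ i j k l m (f ρ ps))) (find-all Γ (path+point i j k l m))
    check Γ Δs (split i j t u) = do
      f ← check (i ∼ j ∷ Γ) Δs t
      g ← check (i ≁ j ∷ Γ) Δs u
      just λ ρ ps → by-cases ρ (f ρ) (g ρ) ps
      where
      by-cases : ∀ ρ → (ρ ⊨ i ∼ j ∷ Γ → OneOf ρ Δs) → (ρ ⊨ i ≁ j ∷ Γ → OneOf ρ Δs) →
        ρ ⊨ Γ → OneOf ρ Δs
      by-cases ρ f g ps with R (ρ i) (ρ j)
      ... | true  = f (refl , ps)
      ... | false = g (refl , ps)

    infix 3 _∣_⊢_

    -- A record lets unification recover the contexts, which are lost once `_⊨_` unfolds. `Γ` and
    -- `Δ` are kept apart so that the evidence for a shared configuration can be passed as a whole.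
    record _∣_⊢_ (Γ Δ : Context) (Δs : List Context) : Set where
      constructor entail
      field apply : ∀ ρ → ρ ⊨ Γ → ρ ⊨ Δ → OneOf ρ Δs
    open _∣_⊢_

    certify : ∀ {Γ Δ Δs} t {_ : IsTrue (is-just (check (Γ ++ Δ) Δs t))} → Γ ∣ Δ ⊢ Δs
    certify {Γ} {Δ} {Δs} t {ok} =
      entail λ ρ p q → to-witness-T (check (Γ ++ Δ) Δs t) ok ρ (⊨-++ Γ p q)

    -- Facts about few vertices

    -- In the second alternative 0, 1, 3, 4 form a stable set, which is impossible when α is 3.
    two-classes : 0 ≁ 1 ∷ 0 ≁ 2 ∷ 1 ≁ 2 ∷ [] ∣ 3 ≁ 0 ∷ 3 ∼ 2 ∷ 4 ≁ 0 ∷ 4 ∼ 2 ∷ [] ⊢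
      (3 ∼ 4 ∷ []) ∷ (3 ≁ 1 ∷ 4 ≁ 1 ∷ 3 ≁ 4 ∷ []) ∷ []
    two-classes = certify
      (split 3 4 (goal 0)
       (split 1 3 (split 1 4 (c4 1 3 2 4) (p4 1 3 2 4 0)) (split 1 4 (p4 1 4 2 3 0) (goal 1))))

    -- This is why a vertex complete to the stable triple that misses some vertex seeing only 2 can
    -- join the class of those missing 1 and seeing 0.
    complete-to-one-class : 0 ≁ 1 ∷ 0 ≁ 2 ∷ 1 ≁ 2 ∷ 3 ∼ 0 ∷ 3 ∼ 1 ∷ 3 ∼ 2 ∷ [] ∣
      4 ≁ 0 ∷ 4 ≁ 1 ∷ 4 ∼ 2 ∷ 3 ≁ 4 ∷ 5 ≁ 1 ∷ 5 ∼ 0 ∷ [] ⊢ (3 ∼ 5 ∷ []) ∷ []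
    complete-to-one-class = certify
      (split 3 5 (goal 0) (split 2 5 (c4 0 3 2 5) (split 4 5 (p4 0 5 4 2 1) (p4 1 3 0 5 4))))

    -- Without a chord, 1234 is a square or forms a `P₄+P₁` with 0.
    path-shortcut : 0 ≁ 1 ∷ 0 ≁ 2 ∷ 0 ≁ 3 ∷ 0 ≁ 4 ∷ [] ∣ 1 ∼ 2 ∷ 2 ∼ 3 ∷ 3 ∼ 4 ∷ [] ⊢
      (1 ∼ 3 ∷ []) ∷ (2 ∼ 4 ∷ []) ∷ (1 ∼ 4 ∷ []) ∷ []
    path-shortcut = certify
      (split 1 3 (goal 0) (split 2 4 (goal 1) (split 1 4 (c4 1 2 3 4) (p4 1 2 3 4 0))))

    -- Squares through 0 rule out that 2 sees 3, that 1 sees 4, or that both 1 and 2 see 5. The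
    -- remaining adjacencies determine which hole arises.
    hole-through : 0 ∼ 1 ∷ 0 ∼ 2 ∷ 1 ≁ 2 ∷ 3 ∼ 1 ∷ 4 ∼ 2 ∷ [] ∣
      0 ≁ 3 ∷ 0 ≁ 4 ∷ 0 ≁ 5 ∷ 3 ∼ 5 ∷ 5 ∼ 4 ∷ [] ⊢
      hole5 0 1 3 4 2 ∷ hole5 0 1 5 4 2 ∷ hole5 0 1 3 5 2 ∷ hole6 0 1 3 5 4 2 ∷ []
    hole-through = certify
      (split 2 3 (c4 0 1 3 2)
       (split 1 4 (c4 0 1 4 2)
        (split 3 4 (goal 0)
         (split 1 5 (split 2 5 (c4 0 1 5 2) (goal 1)) (split 2 5 (goal 2) (goal 3))))))

    -- Puts the tip 5 into the set `D` of `fork-separation`. In all facts about `fork₀`, 0 to 4 are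
    -- `c₁` to `c₅`, and 5, 6 are the tips.
    fork-inner-tip : fork₀ ∣ 7 ∼ 3 ∷ 5 ∼ 7 ∷ [] ⊢ (7 ∼ 0 ∷ 7 ∼ 1 ∷ []) ∷ []
    fork-inner-tip = certify
      (split 0 7
        (split 1 7 (goal 0) (split 2 7 (c4 0 1 2 7) (split 6 7 (c4 1 5 7 6) (p4 2 3 7 5 6))))
        (split 4 7 (c4 0 4 7 5) (split 6 7 (c4 0 5 7 6) (p4 4 3 7 5 6))))

    -- For 7 in `D` and a neighbour 8 of it: every alternative but the first gives 7 a neighbour
    -- that sees 3, namely 8, 2 or 4.
    fork-boundary : fork₀ ∣ 7 ∼ 0 ∷ 7 ∼ 1 ∷ 7 ≁ 3 ∷ 7 ∼ 8 ∷ [] ⊢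
      (8 ∼ 0 ∷ 8 ∼ 1 ∷ []) ∷ (8 ∼ 3 ∷ []) ∷ (7 ∼ 2 ∷ []) ∷ (7 ∼ 4 ∷ []) ∷ []
    fork-boundary = certify
      (split 3 8 (goal 1)
       (split 4 7 (goal 3)
        (split 0 8
          (split 1 8 (goal 0)
           (split 2 8 (c4 0 1 2 8)
            (split 4 8
              (split 5 8 (split 6 8 (c4 1 5 8 6) (p4 2 3 4 8 6)) (p4 2 3 4 8 5))
              (p4 1 2 3 4 8))))
          (split 4 8 (c4 0 4 8 7)
           (split 2 8
             (split 5 8 (split 6 8 (c4 0 5 8 6) (p4 3 2 8 5 6)) (p4 3 4 0 5 8))
             (p4 0 4 3 2 8))))))

    -- Under the first alternative, any two such vertices 7 are common neighbours of the nonadjacent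
    -- tips, hence adjacent.
    fork-far : fork₀ ∣ 7 ∼ 0 ∷ 7 ∼ 1 ∷ 7 ≁ 3 ∷ 8 ∼ 3 ∷ 7 ∼ 8 ∷ [] ⊢
      (5 ∼ 7 ∷ 6 ∼ 7 ∷ []) ∷ (8 ∼ 0 ∷ 8 ∼ 1 ∷ []) ∷ []
    fork-far = certify
      (split 2 7
        (split 4 7 (c4 2 3 4 7) (split 5 7 (split 6 7 (goal 0) (p4 3 2 7 5 6)) (p4 4 3 2 7 5)))
        (split 1 8
          (split 2 8
            (split 0 8 (goal 1)
             (split 4 8 (c4 0 1 8 4)
              (split 4 7 (c4 3 4 7 8)
               (split 5 8
                 (split 6 8 (c4 0 5 8 6) (p4 4 3 8 5 6))
                 (split 5 7 (p4 2 8 7 5 4) (p4 4 3 8 7 5))))))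
            (c4 1 2 3 8))
          (split 2 8 (c4 1 2 8 7)
           (split 5 7
             (split 6 7 (goal 0) (split 6 8 (c4 1 6 8 7) (p4 2 3 8 7 6)))
             (split 5 8 (c4 1 5 8 7) (p4 2 3 8 7 5))))))

    -- Squares force 7 to see the whole hole. This settles pairs of boundary vertices of which
    -- exactly one sees `c₄`.
    fork-complete : fork₀ ∣ 7 ∼ 0 ∷ 7 ∼ 1 ∷ 7 ∼ 3 ∷ 8 ∼ 0 ∷ 8 ∼ 1 ∷ 8 ≁ 3 ∷ 9 ∼ 3 ∷ 8 ∼ 9 ∷ [] ⊢
      (7 ∼ 8 ∷ []) ∷ (9 ∼ 0 ∷ 9 ∼ 1 ∷ []) ∷ []
    fork-complete = certify
      (split 4 7
        (split 2 7
          (split 7 8 (goal 0)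
           (split 2 8 (c4 0 7 2 8)
            (split 4 8 (c4 1 7 4 8)
             (split 0 9
               (split 7 9 (split 1 9 (goal 1) (c4 1 7 9 8)) (c4 0 7 3 9))
               (split 4 9 (c4 0 4 9 8)
                (split 7 9 (c4 0 7 9 8)
                 (split 1 9 (c4 1 7 3 9) (split 2 9 (c4 1 2 9 8) (p4 2 1 0 4 9)))))))))
          (c4 1 2 3 7))
        (c4 0 4 3 7))

    -- The nonneighbours of a vertex of a 5-hole see two or three consecutive
    -- vertices of it, and two of three pairwise nonadjacent ones form a fork.
    fork-from-hole5 : hole5 0 1 2 3 4 ∣ 5 ≁ 0 ∷ 6 ≁ 0 ∷ 7 ≁ 0 ∷ 6 ≁ 5 ∷ 7 ≁ 5 ∷ 7 ≁ 6 ∷ [] ⊢ List.map fork forks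
    fork-from-hole5 = certify
      (split 1 5
        (split 4 5 (c4 0 1 5 4)
         (split 1 6
           (split 4 6 (c4 0 1 6 4)
            (split 3 5
              (split 3 6 (c4 1 5 3 6) (p4 0 4 3 5 6))
              (split 2 5
                (split 3 6 (p4 0 4 3 6 5) (split 2 6 (goal 0) (p4 0 4 3 2 6)))
                (p4 0 4 3 2 5))))
           (split 4 6
             (split 3 5
               (split 3 6
                 (split 1 7
                   (split 4 7 (c4 0 1 7 4) (split 3 7 (c4 1 5 3 7) (p4 0 4 3 5 7)))
                   (split 3 7
                     (split 4 7
                       (split 2 6
                         (split 2 7 (c4 2 6 4 7) (p4 0 1 2 6 7))
                         (split 2 7 (p4 0 1 2 7 6) (goal 8)))
                       (p4 1 0 4 6 7))
                     (p4 0 1 5 3 7)))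
                 (p4 0 1 5 3 6))
               (split 2 5
                 (split 1 7
                   (split 4 7 (c4 0 1 7 4)
                    (split 3 7 (p4 0 4 3 7 5) (split 2 7 (goal 3) (p4 0 4 3 2 7))))
                   (split 4 7
                     (split 2 6
                       (split 2 7 (c4 2 6 4 7) (p4 0 1 2 6 7))
                       (split 3 6 (p4 5 2 3 6 0) (p4 0 1 2 3 6)))
                     (p4 1 0 4 6 7)))
                 (p4 0 4 3 2 5)))
             (p4 4 0 1 5 6))))
        (split 3 5
          (split 1 6
            (split 4 6 (c4 0 1 6 4)
             (split 4 5
               (split 1 7
                 (split 4 7 (c4 0 1 7 4)
                  (split 3 6
                    (split 3 7 (c4 1 6 3 7) (p4 0 4 3 6 7))
                    (split 2 6
                      (split 3 7 (p4 0 4 3 7 6) (split 2 7 (goal 6) (p4 0 4 3 2 7)))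
                      (p4 0 4 3 2 6))))
                 (split 4 7
                   (split 2 5
                     (split 2 7 (c4 2 5 4 7) (p4 0 1 2 5 7))
                     (split 2 7 (p4 0 1 2 7 5) (split 3 7 (goal 5) (p4 0 1 2 3 7))))
                   (p4 1 0 4 5 7)))
               (p4 4 0 1 6 5)))
            (split 2 5
              (split 2 6
                (split 4 5
                  (split 4 6 (c4 2 5 4 6) (p4 1 0 4 5 6))
                  (split 4 6 (p4 1 0 4 6 5) (split 3 6 (goal 1) (p4 0 4 3 5 6))))
                (p4 0 1 2 5 6))
              (split 2 6 (p4 0 1 2 6 5)
               (split 3 6
                 (split 4 5 (split 4 6 (goal 2) (p4 1 0 4 5 6)) (p4 2 1 0 4 5))
                 (p4 0 1 2 3 6)))))
          (split 2 5 (split 4 5 (c4 2 3 4 5) (p4 1 0 4 3 5)) (p4 0 1 2 3 5))))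

    -- A nonneighbour of 0 either sees 3 and exactly one of 1, 5, or it misses 1 and 5 and sees 2
    -- and 4. Two of the same kind are adjacent, as otherwise there is a square; one of the last
    -- kind is adjacent to all others. So at most two are pairwise nonadjacent.
    no-hole6 : hole6 0 1 2 3 4 5 ∣ 6 ≁ 0 ∷ 7 ≁ 0 ∷ 8 ≁ 0 ∷ 7 ≁ 6 ∷ 8 ≁ 6 ∷ 8 ≁ 7 ∷ [] ⊢ []
    no-hole6 = certify
      (split 1 6
        (split 5 6 (c4 0 1 6 5)
         (split 3 6
           (split 1 7
             (split 5 7 (c4 0 1 7 5) (split 3 7 (c4 1 6 3 7) (p4 3 6 1 7 5)))
             (split 3 7
               (split 5 7
                 (split 1 8
                   (split 5 8 (c4 0 1 8 5) (split 3 8 (c4 1 6 3 8) (p4 0 5 7 3 8)))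
                   (split 3 8 (split 5 8 (c4 3 7 5 8) (p4 1 0 5 7 8)) (p4 0 1 6 3 8)))
                 (p4 1 6 3 7 5))
               (p4 0 1 6 3 7)))
           (p4 5 0 1 6 3)))
        (split 5 6
          (split 3 6
            (split 1 7
              (split 5 7 (c4 0 1 7 5)
               (split 3 7
                 (split 1 8
                   (split 5 8 (c4 0 1 8 5) (split 3 8 (c4 1 7 3 8) (p4 0 5 6 3 8)))
                   (split 3 8 (split 5 8 (c4 3 6 5 8) (p4 1 0 5 6 8)) (p4 0 1 7 3 8)))
                 (p4 0 5 6 3 7)))
              (split 5 7 (split 3 7 (c4 3 6 5 7) (p4 1 0 5 7 3)) (p4 1 0 5 6 7)))
            (p4 1 0 5 6 3))
          (split 4 6
            (split 2 6
              (split 1 7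
                (split 5 7 (c4 0 1 7 5) (p4 5 0 1 7 6))
                (split 2 7 (split 4 7 (c4 2 6 4 7) (p4 0 1 2 7 4)) (p4 0 1 2 6 7)))
              (p4 0 5 4 6 2))
            (p4 1 0 5 4 6))))

    common-neighbours : ∀ {u v x y} → R u v ≡ false →
      R u x ≡ true → R v x ≡ true → R u y ≡ true → R v y ≡ true → R x y ≡ true
    common-neighbours {u} {v} {x} {y} uv ux vx uy vy with R x y in xy
    ... | true  = refl
    ... | false = ⊥-elim (no-square (at (u ∷ x ∷ v ∷ y ∷ [])) 0 1 2 3
      (ux , flip-R vx , vy , flip-R uy , uv , xy , tt))

    -- Covering a vertex set by three cliques

    module _ (S : Subset (n G)) where

      -- S contains k further vertices which together with us form a stable set,
      -- provided that us does.
      Stable : ℕ → List V → Set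
      Stable zero    us = ⊤
      Stable (suc k) us = ∃ λ v → v ∈ S × All (λ u → R v u ≡ false) us × Stable k (v ∷ us)

      stable? : ∀ k us → Dec (Stable k us)
      stable? zero    us = yes tt
      stable? (suc k) us = any? λ v →
        (v ∈? S) ×-dec All.all? (λ u → R v u Bool.≟ false) us ×-dec stable? k (v ∷ us)

      -- The classes may overlap; `classify` chooses one for each vertex.
      cover-by-classes : (Class : Fin 3 → V → Set) → (∀ {v} → v ∈ S → ∃[ k ] Class k v) →
        (∀ k {u v} → u ∈ S → v ∈ S → Class k u → Class k v → R u v ≡ true) →
        CliqueCoverAtMost G (_∈ S) 3
      cover-by-classes Class classify clique = colour , λ u v u∈ v∈ u≢v same →
        R⇒adj u≢v (clique (colour v) u∈ v∈ (subst (λ k → Class k u) same (colour-class u∈)) (colour-class v∈))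
        where
        colour : V → Fin 3
        colour v with v ∈? S
        ... | yes v∈ = proj₁ (classify v∈)
        -- Vertices outside `S` are unconstrained, so any colour will do.
        ... | no _   = zero
        colour-class : ∀ {v} → v ∈ S → Class (colour v) v
        colour-class {v} v∈ with v ∈? S
        ... | yes v∈′ = proj₂ (classify v∈′)
        ... | no v∉   = contradiction v∈ v∉

      cover₁ : ¬ Stable 2 [] → CliqueCoverAtMost G (_∈ S) 3
      cover₁ none = cover-by-classes (λ _ _ → ⊤) (λ _ → zero , tt) λ _ u∈ v∈ _ _ → adjacent u∈ v∈
        where
        adjacent : ∀ {u v} → u ∈ S → v ∈ S → R u v ≡ true
        adjacent {u} {v} u∈ v∈ with R u v in uv
        ... | true  = refl
        ... | false = contradiction (v , v∈ , [] , u , u∈ , uv ∷ [] , tt) none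

      -- Nonadjacent vertices both missing `a`, or both missing `b`, would complete a stable triple;
      -- common neighbours of `a` and `b` are pairwise adjacent.
      cover₂ : ¬ Stable 3 [] → Stable 2 [] → CliqueCoverAtMost G (_∈ S) 3
      cover₂ none (a , a∈ , _ , b , b∈ , ba ∷ [] , _) = cover-by-classes Class classify clique
        where
        Class : Fin 3 → V → Set
        Class 0F x = R x a ≡ false
        Class 1F x = R x b ≡ false
        Class 2F x = R a x ≡ true × R b x ≡ true
        classify : ∀ {v} → v ∈ S → ∃[ k ] Class k v
        classify {v} _ with R v a in va | R v b in vb
        ... | false | _     = 0F , va
        ... | true  | false = 1F , vb
        ... | true  | true  = 2F , flip-R va , flip-R vb
        missed-by : ∀ {w u v} → w ∈ S → u ∈ S → v ∈ S → R u w ≡ false → R v w ≡ false → R u v ≡ true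
        missed-by {w} {u} {v} w∈ u∈ v∈ uw vw with R u v in uv
        ... | true  = refl
        ... | false = contradiction
          (w , w∈ , [] , v , v∈ , vw ∷ [] , u , u∈ , uv ∷ uw ∷ [] , tt) none
        clique : ∀ k {u v} → u ∈ S → v ∈ S → Class k u → Class k v → R u v ≡ true
        clique 0F u∈ v∈ ua va = missed-by a∈ u∈ v∈ ua va
        clique 1F u∈ v∈ ub vb = missed-by b∈ u∈ v∈ ub vb
        clique 2F _ _ (au , bu) (av , bv) = common-neighbours (flip-R ba) au bu av bv

      -- The vertices missing a but not c, those missing b but not a, and those
      -- missing c but not b form cliques. A vertex complete to a, b, c can join the
      -- first class unless it misses a vertex seeing only c; then it can join the
      -- second.
      cover₃ : ¬ Stable 4 [] → Stable 3 [] → CliqueCoverAtMost G (_∈ S) 3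
      cover₃ none (a , a∈ , _ , b , b∈ , ba ∷ [] , c , c∈ , cb ∷ ca ∷ [] , _) =
        cover-by-classes Class classify clique
        where
        Complete OnlyC : V → Set
        Complete x = R x a ≡ true × R x b ≡ true × R x c ≡ true
        OnlyC x = R x a ≡ false × R x b ≡ false × R x c ≡ true
        Class : Fin 3 → V → Set
        Class 0F x = R x a ≡ false × R x c ≡ true
          ⊎ Complete x × (∀ {y} → y ∈ S → OnlyC y → R x y ≡ true)
        Class 1F x = R x b ≡ false × R x a ≡ true
          ⊎ Complete x × ∃ λ y → y ∈ S × OnlyC y × R x y ≡ false
        Class 2F x = R x c ≡ false × R x b ≡ true
        onlyC? : ∀ x → Dec (OnlyC x)
        onlyC? x = (R x a Bool.≟ false) ×-dec (R x b Bool.≟ false) ×-dec (R x c Bool.≟ true)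
        classify : ∀ {v} → v ∈ S → ∃[ k ] Class k v
        classify {v} v∈ with R v a in va | R v b in vb | R v c in vc
        ... | false | _     | true  = 0F , inj₁ (va , vc)
        ... | true  | false | _     = 1F , inj₁ (vb , va)
        ... | _     | true  | false = 2F , vc , vb
        ... | false | false | false = contradiction
          (a , a∈ , [] , b , b∈ , ba ∷ [] , c , c∈ , cb ∷ ca ∷ [] , v , v∈ , vc ∷ vb ∷ va ∷ [] , tt) none
        ... | true  | true  | true
          with any? (λ y → (y ∈? S) ×-dec onlyC? y ×-dec (R v y Bool.≟ false))
        ...   | yes missed = 1F , inj₂ ((va , vb , vc) , missed)
        ...   | no all = 0F , inj₂ ((va , vb , vc) , λ y∈ only → Bool.¬-not λ r → all (_ , y∈ , only , r))
        misses-first-sees-third : ∀ {p q r u v} → p ∈ S → q ∈ S → r ∈ S → u ∈ S → v ∈ S →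
          R p q ≡ false → R p r ≡ false → R q r ≡ false →
          R u p ≡ false → R u r ≡ true → R v p ≡ false → R v r ≡ true → R u v ≡ true
        misses-first-sees-third {p} {q} {r} {u} {v} p∈ q∈ r∈ u∈ v∈ pq pr qr up ur vp vr
          with apply two-classes
            (at (p ∷ q ∷ r ∷ u ∷ v ∷ [])) (pq , pr , qr , tt) (up , ur , vp , vr , tt)
        ... | inj₁ (uv , _) = uv
        ... | inj₂ (inj₁ (uq , vq , uv , _)) = contradiction
          (p , p∈ , [] , q , q∈ , flip-R pq ∷ [] , v , v∈ , vq ∷ vp ∷ [] , u , u∈ , uv ∷ uq ∷ up ∷ [] , tt) none
        complete-clique : ∀ {u v} → Complete u → Complete v → R u v ≡ true
        complete-clique (ua , ub , _) (va , vb , _) =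
          common-neighbours (flip-R ba) (flip-R ua) (flip-R ub) (flip-R va) (flip-R vb)
        clique₀ : ∀ {u v} → u ∈ S → R u a ≡ false → R u c ≡ true → Complete v →
          (∀ {y} → y ∈ S → OnlyC y → R v y ≡ true) → R v u ≡ true
        -- If `u` sees `b`, then `u` and `v` are common neighbours of the nonadjacent `b` and `c`;
        -- otherwise `u` sees only `c`.
        clique₀ {u} u∈ ua uc (_ , vb , vc) all with R u b in ub
        ... | false = all u∈ (ua , ub , uc)
        ... | true  = common-neighbours cb (flip-R vc) (flip-R vb) (flip-R uc) (flip-R ub)
        clique₁ : ∀ {u v y} → R u b ≡ false → R u a ≡ true → Complete v →
          OnlyC y → R v y ≡ false → R v u ≡ true
        clique₁ {u} {v} {y} ub ua (va , vb , vc) (ya , yb , yc) vy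
          with apply complete-to-one-class
            (at (a ∷ b ∷ c ∷ v ∷ y ∷ u ∷ []))
            (flip-R ba , flip-R ca , flip-R cb , va , vb , vc , tt) (ya , yb , yc , vy , ub , ua , tt)
        ... | inj₁ (vu , _) = vu
        clique : ∀ k {u v} → u ∈ S → v ∈ S → Class k u → Class k v → R u v ≡ true
        clique 0F u∈ v∈ (inj₁ (ua , uc)) (inj₁ (va , vc)) =
          misses-first-sees-third a∈ b∈ c∈ u∈ v∈ (flip-R ba) (flip-R ca) (flip-R cb) ua uc va vc
        clique 0F u∈ _ (inj₁ (ua , uc)) (inj₂ (v , all)) = flip-R (clique₀ u∈ ua uc v all)
        clique 0F _ v∈ (inj₂ (u , all)) (inj₁ (va , vc)) = clique₀ v∈ va vc u all
        clique 0F _ _ (inj₂ (u , _)) (inj₂ (v , _)) = complete-clique u v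
        clique 1F u∈ v∈ (inj₁ (ub , ua)) (inj₁ (vb , va)) =
          misses-first-sees-third b∈ c∈ a∈ u∈ v∈ (flip-R cb) ba ca ub ua vb va
        clique 1F _ _ (inj₁ (ub , ua)) (inj₂ (v , _ , _ , only , vy)) = flip-R (clique₁ ub ua v only vy)
        clique 1F _ _ (inj₂ (u , _ , _ , only , uy)) (inj₁ (vb , va)) = clique₁ vb va u only uy
        clique 1F _ _ (inj₂ (u , _)) (inj₂ (v , _)) = complete-clique u v
        clique 2F u∈ v∈ (uc , ub) (vc , vb) =
          misses-first-sees-third c∈ a∈ b∈ u∈ v∈ ca cb (flip-R ba) uc ub vc vb

      -- Clique cutsets and forks

      Boundary : Subset (n G) → V → Set
      Boundary D u = u ∈ S × u ∉ D × ∃ λ d → d ∈ D × R d u ≡ true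

      boundary? : ∀ D u → Dec (Boundary D u)
      boundary? D u = (u ∈? S) ×-dec ¬? (u ∈? D) ×-dec
        any? λ d → (d ∈? D) ×-dec (R d u Bool.≟ true)

      -- The sides are the closed neighbourhood of `D` in `S` and the complement of `D` in `S`; they
      -- meet in the boundary. `z` keeps the first proper, `d` the second.
      separate : ∀ D {d z} → D ⊆ S → d ∈ D → z ∈ S → (∀ {v} → v ∈ D → R v z ≡ false) →
        (∀ {u v} → Boundary D u → Boundary D v → R u v ≡ true) → CliqueSeparation S
      separate D {d} {z} D⊆S d∈D z∈S far clique = record
        { left = sift near? ; right = sift outside?
        ; left⊂ = (proj₁ ∘ ∈-sift⁻ near?) , z , z∈S , λ z∈l →
            let _ , v , v∈D , vz = ∈-sift⁻ near? z∈l
            in case trans (≡-sym (far v∈D)) vz of λ ()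
        ; right⊂ = (proj₁ ∘ ∈-sift⁻ outside?) , d , D⊆S d∈D , λ d∈r → proj₂ (∈-sift⁻ outside? d∈r) d∈D
        ; covers = covers
        ; middle = λ u∈l u∈r v∈l v∈r → clique (boundary u∈l u∈r) (boundary v∈l v∈r)
        ; separated = separated }
        where
        near? : ∀ v → Dec (v ∈ S × ∃ λ d → d ∈ D × R d v ≡ true)
        near? v = (v ∈? S) ×-dec any? λ d → (d ∈? D) ×-dec (R d v Bool.≟ true)
        outside? : ∀ v → Dec (v ∈ S × v ∉ D)
        outside? v = (v ∈? S) ×-dec ¬? (v ∈? D)
        boundary : ∀ {u} → u ∈ sift near? → u ∈ sift outside? → Boundary D u
        boundary u∈l u∈r =
          let u∈S , attached = ∈-sift⁻ near? u∈l in u∈S , proj₂ (∈-sift⁻ outside? u∈r) , attached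
        covers : ∀ {v} → v ∈ S → v ∈ sift near? ⊎ v ∈ sift outside?
        covers {v} v∈S with v ∈? D
        ... | yes v∈D = inj₁ (∈-sift⁺ near? (v∈S , v , v∈D , R-refl v))
        ... | no v∉D  = inj₂ (∈-sift⁺ outside? (v∈S , v∉D))
        separated : ∀ {u v} → u ∈ sift near? → v ∈ sift outside? → R u v ≡ true →
          u ∈ sift outside? ⊎ v ∈ sift near?
        separated {u} {v} u∈l v∈r uv with u ∈? D
        ... | yes u∈D = inj₂ (∈-sift⁺ near? (proj₁ (∈-sift⁻ outside? v∈r) , u , u∈D , uv))
        ... | no u∉D  = inj₁ (∈-sift⁺ outside? (proj₁ (∈-sift⁻ near? u∈l) , u∉D))

      Fork : Set
      Fork = Σ (Vec V 7) λ vs → VecAll.All (_∈ S) vs × at vs ⊨ fork₀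

      -- D collects w and the vertices like it: attached to the hole at c₁ and c₂, and
      -- seeing no neighbour of c₄ except those complete to that edge. A boundary vertex
      -- of D either sees c₁, c₂, c₄, or sees both tips w and w′ of the fork.
      fork-separation : Fork → CliqueSeparation S
      fork-separation ((c₁ ∷ c₂ ∷ c₃ ∷ c₄ ∷ c₅ ∷ w ∷ w′ ∷ []) , (c₁∈ ∷ c₂∈ ∷ c₃∈ ∷ c₄∈ ∷ c₅∈ ∷ w∈ ∷ w′∈ ∷ []) ,
          F@(c₁c₂ , c₂c₃ , c₃c₄ , c₄c₅ , c₅c₁ , c₁c₃ , c₁c₄ , c₂c₄ , c₂c₅ , c₃c₅ ,
            wc₁ , wc₂ , wc₃ , wc₄ , wc₅ , _ , _ , _ , _ , _ , ww′ , _)) =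
        separate D (proj₁ ∘ ∈-sift⁻ inner?) w∈D c₄∈ (λ v∈D → let _ , _ , _ , vc₄ , _ = ∈-sift⁻ inner? v∈D in vc₄) clique
        where
        Far Inner : V → Set
        Far v = ∃ λ x → x ∈ S × R x c₄ ≡ true × R v x ≡ true × ¬ (R x c₁ ≡ true × R x c₂ ≡ true)
        Inner v = v ∈ S × R v c₁ ≡ true × R v c₂ ≡ true × R v c₄ ≡ false × ¬ Far v
        far? : ∀ v → Dec (Far v)
        far? v = any? λ x → (x ∈? S) ×-dec (R x c₄ Bool.≟ true) ×-dec (R v x Bool.≟ true) ×-dec
          ¬? ((R x c₁ Bool.≟ true) ×-dec (R x c₂ Bool.≟ true))
        inner? : ∀ v → Dec (Inner v)
        inner? v = (v ∈? S) ×-dec (R v c₁ Bool.≟ true) ×-dec (R v c₂ Bool.≟ true) ×-dec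
          (R v c₄ Bool.≟ false) ×-dec ¬? (far? v)
        D : Subset (n G)
        D = sift inner?

        w-not-far : ¬ Far w
        w-not-far (x , _ , xc₄ , wx , ¬xc) with apply fork-inner-tip
          (at (c₁ ∷ c₂ ∷ c₃ ∷ c₄ ∷ c₅ ∷ w ∷ w′ ∷ x ∷ [])) F (xc₄ , wx , tt)
        ... | inj₁ (xc₁ , xc₂ , _) = ¬xc (xc₁ , xc₂)
        w∈D : w ∈ D
        w∈D = ∈-sift⁺ inner? (w∈ , wc₁ , wc₂ , wc₄ , w-not-far)

        sees-edge : ∀ {k} → Boundary D k → R k c₁ ≡ true × R k c₂ ≡ true
        sees-edge {k} (k∈S , _ , d , d∈D , dk) with ∈-sift⁻ inner? d∈D
        ... | _ , dc₁ , dc₂ , dc₄ , not-far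
          with apply fork-boundary
          (at (c₁ ∷ c₂ ∷ c₃ ∷ c₄ ∷ c₅ ∷ w ∷ w′ ∷ d ∷ k ∷ [])) F (dc₁ , dc₂ , dc₄ , dk , tt)
        ... | inj₁ (kc₁ , kc₂ , _) = kc₁ , kc₂
        ... | inj₂ (inj₁ (kc₄ , _)) = decidable-stable ((R k c₁ Bool.≟ true) ×-dec (R k c₂ Bool.≟ true))
          λ ¬kc → not-far (k , k∈S , kc₄ , dk , ¬kc)
        -- `c₃` sees `c₄` but not `c₁`, so it would make `d` far; likewise `c₅`, which misses `c₂`.
        ... | inj₂ (inj₂ (inj₁ (dc₃ , _))) = contradiction
          (c₃ , c₃∈ , c₃c₄ , dc₃ , λ { (c₃c₁ , _) → case trans (≡-sym (flip-R c₁c₃)) c₃c₁ of λ () }) not-far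
        ... | inj₂ (inj₂ (inj₂ (inj₁ (dc₅ , _)))) = contradiction
          (c₅ , c₅∈ , flip-R c₄c₅ , dc₅ , λ { (_ , c₅c₂) → case trans (≡-sym (flip-R c₂c₅)) c₅c₂ of λ () }) not-far

        sees-far : ∀ {k} → Boundary D k → R k c₄ ≡ false → Far k
        sees-far {k} k∈B@(k∈S , k∉D , _) kc₄ = decidable-stable (far? k) λ not-far →
          let kc₁ , kc₂ = sees-edge k∈B in k∉D (∈-sift⁺ inner? (k∈S , kc₁ , kc₂ , kc₄ , not-far))

        sees-tips : ∀ {k} → R k c₁ ≡ true → R k c₂ ≡ true → R k c₄ ≡ false → Far k →
          R w k ≡ true × R w′ k ≡ true
        sees-tips {k} kc₁ kc₂ kc₄ (x , _ , xc₄ , kx , ¬xc) with apply fork-far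
          (at (c₁ ∷ c₂ ∷ c₃ ∷ c₄ ∷ c₅ ∷ w ∷ w′ ∷ k ∷ x ∷ [])) F (kc₁ , kc₂ , kc₄ , xc₄ , kx , tt)
        ... | inj₁ (wk , w′k , _) = wk , w′k
        ... | inj₂ (inj₁ (xc₁ , xc₂ , _)) = contradiction (xc₁ , xc₂) ¬xc

        complete-sees-far : ∀ {u k} → R u c₁ ≡ true → R u c₂ ≡ true → R u c₄ ≡ true →
          R k c₁ ≡ true → R k c₂ ≡ true → R k c₄ ≡ false → Far k → R u k ≡ true
        complete-sees-far {u} {k} uc₁ uc₂ uc₄ kc₁ kc₂ kc₄ (x , _ , xc₄ , kx , ¬xc) with apply fork-complete
          (at (c₁ ∷ c₂ ∷ c₃ ∷ c₄ ∷ c₅ ∷ w ∷ w′ ∷ u ∷ k ∷ x ∷ [])) F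
          (uc₁ , uc₂ , uc₄ , kc₁ , kc₂ , kc₄ , xc₄ , kx , tt)
        ... | inj₁ (uk , _) = uk
        ... | inj₂ (inj₁ (xc₁ , xc₂ , _)) = contradiction (xc₁ , xc₂) ¬xc

        -- Two vertices seeing `c₄` are common neighbours of `c₂` and `c₄`; two missing it are
        -- common neighbours of the tips.
        clique : ∀ {u v} → Boundary D u → Boundary D v → R u v ≡ true
        clique {u} {v} u∈B v∈B with sees-edge u∈B | sees-edge v∈B | R u c₄ in uc₄ | R v c₄ in vc₄
        ... | _ , uc₂ | _ , vc₂ | true | true =
          common-neighbours c₂c₄ (flip-R uc₂) (flip-R uc₄) (flip-R vc₂) (flip-R vc₄)
        ... | uc₁ , uc₂ | vc₁ , vc₂ | true | false =
          complete-sees-far uc₁ uc₂ uc₄ vc₁ vc₂ vc₄ (sees-far v∈B vc₄)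
        ... | uc₁ , uc₂ | vc₁ , vc₂ | false | true =
          flip-R (complete-sees-far vc₁ vc₂ vc₄ uc₁ uc₂ uc₄ (sees-far u∈B uc₄))
        ... | uc₁ , uc₂ | vc₁ , vc₂ | false | false =
          let wu , w′u = sees-tips uc₁ uc₂ uc₄ (sees-far u∈B uc₄)
              wv , w′v = sees-tips vc₁ vc₂ vc₄ (sees-far v∈B vc₄)
          in common-neighbours ww′ wu w′u wv w′v

      -- Clique cutsets from stable sets of size four

      at-∈ : ∀ {k} {vs : Vec V (suc k)} → VecAll.All (_∈ S) vs → ∀ i → at vs i ∈ S
      at-∈ (x∈ ∷ _)           zero    = x∈
      at-∈ (x∈ ∷ [])          (suc _) = x∈
      at-∈ (_ ∷ xs∈@(_ ∷ _)) (suc i) = at-∈ xs∈ i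

      fork-among : ∀ {ρ} → (∀ i → ρ i ∈ S) → ∀ iss → OneOf ρ (List.map fork iss) → Fork
      fork-among {ρ} ρ∈ ((a ∷ b ∷ c ∷ d ∷ e ∷ p ∷ q ∷ []) ∷ iss) (inj₁ F) =
        (ρ a ∷ ρ b ∷ ρ c ∷ ρ d ∷ ρ e ∷ ρ p ∷ ρ q ∷ []) ,
        (ρ∈ a ∷ ρ∈ b ∷ ρ∈ c ∷ ρ∈ d ∷ ρ∈ e ∷ ρ∈ p ∷ ρ∈ q ∷ []) , F
      fork-among ρ∈ (_ ∷ iss) (inj₂ F) = fork-among ρ∈ iss F

      -- C is the component of b among the nonneighbours of a: these induce a P₄-free
      -- graph, so linked vertices are at distance at most two. Two nonadjacent boundary
      -- vertices of C lie on a hole through a.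
      stable₄-separation : Stable 4 [] → CliqueSeparation S
      stable₄-separation
        (a , a∈ , _ , b , b∈ , ba ∷ [] , c , c∈ , cb ∷ ca ∷ [] , d , d∈ , dc ∷ db ∷ da ∷ [] , _) = separation
        where
        -- As `R` is reflexive, this includes distances zero and one.
        Link : V → V → Set
        Link p q = ∃ λ m → m ∈ S × R a m ≡ false × R p m ≡ true × R m q ≡ true
        Member : V → Set
        Member q = q ∈ S × R a q ≡ false × Link b q
        member? : ∀ q → Dec (Member q)
        member? q = (q ∈? S) ×-dec (R a q Bool.≟ false) ×-dec any? λ m →
          (m ∈? S) ×-dec (R a m Bool.≟ false) ×-dec (R b m Bool.≟ true) ×-dec (R m q Bool.≟ true)
        C : Subset (n G)
        C = sift member?

        link-sym : ∀ {p q} → Link p q → Link q p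
        link-sym (m , m∈ , am , pm , mq) = m , m∈ , am , flip-R mq , flip-R pm

        link-step : ∀ {p q q′} → R a p ≡ false → q ∈ S → R a q ≡ false → q′ ∈ S → R a q′ ≡ false →
          Link p q → R q q′ ≡ true → Link p q′
        link-step {p} {q} {q′} ap q∈ aq q′∈ aq′ (m , m∈ , am , pm , mq) qq′ with apply path-shortcut
          (at (a ∷ p ∷ m ∷ q ∷ q′ ∷ [])) (ap , am , aq , aq′ , tt) (pm , mq , qq′ , tt)
        ... | inj₁ (pq , _)                = q , q∈ , aq , pq , qq′
        ... | inj₂ (inj₁ (mq′ , _))        = m , m∈ , am , pm , mq′
        ... | inj₂ (inj₂ (inj₁ (pq′ , _))) = q′ , q′∈ , aq′ , pq′ , R-refl q′

        -- The walk from `p` to `b` is prolonged along `b`, `m`, `q` and shortened to length two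
        -- after each edge.
        members-linked : ∀ {p q} → Member p → Member q → Link p q
        members-linked (p∈ , ap , bp) (q∈ , aq , m , m∈ , am , bm , mq) =
          link-step ap m∈ am q∈ aq (link-step ap b∈ (flip-R ba) m∈ am (link-sym bp) bm) mq

        -- A boundary vertex missing `a` would be linked to `b` and so belong to `C`.
        boundary-sees-a : ∀ {x} → Boundary C x → R a x ≡ true
        boundary-sees-a {x} (x∈ , x∉C , q , q∈C , qx) with R a x in ax
        ... | true  = refl
        ... | false = let q∈ , aq , bq = ∈-sift⁻ member? q∈C in contradiction
          (∈-sift⁺ member? (x∈ , ax , link-step (flip-R ba) q∈ aq x∈ ax bq qx)) x∉C

        stable-bcd : at (a ∷ b ∷ c ∷ d ∷ []) ⊨ 1 ≁ 0 ∷ 2 ≁ 0 ∷ 3 ≁ 0 ∷ 2 ≁ 1 ∷ 3 ≁ 1 ∷ 3 ≁ 2 ∷ []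
        stable-bcd = ba , ca , da , cb , db , dc , tt

        via-hole5 : ∀ {p q r s} → p ∈ S → q ∈ S → r ∈ S → s ∈ S →
          at (a ∷ p ∷ q ∷ r ∷ s ∷ []) ⊨ hole5 0 1 2 3 4 → CliqueSeparation S
        via-hole5 {p} {q} {r} {s} p∈ q∈ r∈ s∈ hole = fork-separation
          (fork-among (at-∈ (a∈ ∷ p∈ ∷ q∈ ∷ r∈ ∷ s∈ ∷ b∈ ∷ c∈ ∷ d∈ ∷ [])) forks
            (apply fork-from-hole5 (at (a ∷ p ∷ q ∷ r ∷ s ∷ b ∷ c ∷ d ∷ [])) hole stable-bcd))

        from-boundary : ∀ {x y} → Boundary C x → Boundary C y → R x y ≡ false → CliqueSeparation S
        from-boundary {x} {y} x∈B@(x∈ , _ , p , p∈C , px) y∈B@(y∈ , _ , q , q∈C , qy) xy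
          with ∈-sift⁻ member? p∈C | ∈-sift⁻ member? q∈C
        ... | p-member@(p∈ , ap , _) | q-member@(q∈ , aq , _)
          with members-linked p-member q-member
        ... | m , m∈ , am , pm , mq
          with apply hole-through
          (at (a ∷ x ∷ y ∷ p ∷ q ∷ m ∷ []))
            (boundary-sees-a x∈B , boundary-sees-a y∈B , xy , px , qy , tt) (ap , aq , am , pm , mq , tt)
        ... | inj₁ hole                      = via-hole5 x∈ p∈ q∈ y∈ hole
        ... | inj₂ (inj₁ hole)               = via-hole5 x∈ m∈ q∈ y∈ hole
        ... | inj₂ (inj₂ (inj₁ hole))        = via-hole5 x∈ p∈ m∈ y∈ hole
        ... | inj₂ (inj₂ (inj₂ (inj₁ hole))) = ⊥-elim
          (apply no-hole6 (at (a ∷ x ∷ p ∷ m ∷ q ∷ y ∷ b ∷ c ∷ d ∷ [])) hole stable-bcd)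

        separation : CliqueSeparation S
        separation
          with any? (λ x → any? λ y → boundary? C x ×-dec boundary? C y ×-dec (R x y Bool.≟ false))
        ... | yes (x , y , x∈B , y∈B , xy) = from-boundary x∈B y∈B xy
        -- The boundary is a clique, so `C` is cut off, with `a` on the other side.
        ... | no none = separate C (proj₁ ∘ ∈-sift⁻ member?)
          (∈-sift⁺ member? (b∈ , flip-R ba , b , b∈ , flip-R ba , R-refl b , R-refl b)) a∈
          (λ v∈C → flip-R (proj₁ (proj₂ (∈-sift⁻ member? v∈C))))
          (λ x∈B y∈B → Bool.¬-not λ xy → none (_ , _ , x∈B , y∈B , xy))

      cover-or-separation : CliqueCoverAtMost G (_∈ S) 3 ⊎ CliqueSeparation S
      cover-or-separation with stable? 4 [] | stable? 3 [] | stable? 2 []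
      ... | yes four | _         | _       = inj₂ (stable₄-separation four)
      ... | no ¬four | yes three | _       = inj₁ (cover₃ ¬four three)
      ... | no _     | no ¬three | yes two = inj₁ (cover₂ ¬three two)
      ... | no _     | no _      | no ¬two = inj₁ (cover₁ ¬two)

theorem1p10 : (G : Graph) → P4+P1-C4-free G → TreeThetaAtMost G 3
theorem1p10 G free = tree-theta G (cover-or-separation G free)
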